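{- For any graph $G$ without isolated vertices and any graph $H$, $$\gamma_R^p(G\circ H)\le \min_{S\in \wp_o(G)}\Big\{ |S_0|\,(|V(H)|-\Delta(H)+1) + |S_1|\,(2+\delta(H))+|V(H)|\,(|V(G)|-|N[S]|)\Big\}.$$
   Context: All graphs are finite, simple and undirected, with at least one vertex. $\delta(H)$ and $\Delta(H)$ are the minimum and maximum degrees of $H$. $N(v)$ is the open neighbourhood of $v$; for a set $S$, $N(S)=\bigcup_{v\in S}N(v)$ and $N[S]=N(S)\cup S$. An open packing of $G$ is a set $S\subseteq V(G)$ with $N(u)\cap N(v)=\varnothing$ for all distinct $u,v\in S$; $\wp_o(G)$ is the set of all open packings of $G$. For $S\in\wp_o(G)$, $S_0$ denotes the set of isolated vertices of the induced subgraph $G[S]$ and $S_1=S\setminus S_0$. A perfect Roman dominating function (PRDF) on a graph $\Gamma$ is a function $f:V(\Gamma)\to\{0,1,2\}$ such that every vertex $u$ with $f(u)=0$ is adjacent to exactly one vertex $v$ with $f(v)=2$. Its weight is $\sum_v f(v)$, and $\gamma_R^p(\Gamma)$ is the minimum weight of a PRDF on $\Gamma$. The lexicographic product $G\circ H$ has vertex set $V(G)\times V(H)$, with $(u,v)$ adjacent to $(x,y)$ iff $ux\in E(G)$, or $u=x$ and $vy\in E(H)$. -}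

module Defs where

open import Level using (0ℓ)
open import Data.Bool.Base using (Bool; true; false; T; if_then_else_)
open import Data.Bool.Properties using (T?)
open import Data.Fin.Base using (Fin; zero; suc; toℕ)
import Data.Fin.Properties as Fin
open import Data.Nat.Base using (ℕ; _+_; _≤_)
open import Data.Nat.ListAction using (sum)
open import Data.Nat.Properties using (≤-trans; ≤-reflexive)
open import Data.List.Base using (List; []; _∷_; map; filter; length; allFin; cartesianProduct; cartesianProductWith)
open import Data.List.Properties using (map-cong)
open import Data.List.Extrema.Nat using (min; max; argmin; argmin-all; f[argmin]≤f[xs])
open import Data.List.Membership.Propositional using (_∈_; find; lose)
open import Data.List.Membership.Propositional.Properties using (∈-cartesianProduct⁺; ∈-cartesianProductWith⁺; ∈-filter⁺; ∈-allFin)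
open import Data.List.Relation.Unary.All as All using (All)
open import Data.List.Relation.Unary.All.Properties using (all-filter)
open import Data.List.Relation.Unary.Any as Any using (here; there)
open import Data.List.Relation.Unary.Unique.Propositional using (Unique)
open import Data.List.Relation.Unary.Unique.Propositional.Properties using (cartesianProduct⁺)
open import Data.Product using (∃; ∃!; _×_; _,_; proj₁; proj₂)
open import Data.Product.Properties using (≡-dec)
open import Data.Sum.Base using (_⊎_; inj₁; inj₂)
open import Data.Empty using (⊥-elim)
open import Function.Base using (const; _∘_)
open import Relation.Nullary using (¬_; Dec; does; yes; no)
open import Relation.Nullary.Decidable using (map′; ¬?; _×-dec_; _⊎-dec_; _→-dec_)
import Relation.Unary as U
open import Relation.Unary using (Pred; _∩_; _∪_; _∖_; Empty)
open import Relation.Unary.Properties using (_∪?_)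
open import Relation.Binary using (Rel; Symmetric; DecidableEquality)
import Relation.Binary as B
open import Relation.Binary.PropositionalEquality using (_≡_; _≢_; _≗_; refl; sym; trans; cong; subst)

-- Finite, simple, undirected graphs with at least one vertex.  Finiteness is
-- given by a duplicate-free list of all vertices.
record Graph : Set₁ where
  field
    V          : Set
    _≟_        : DecidableEquality V
    vertices   : List V
    unique     : Unique vertices
    complete   : ∀ v → v ∈ vertices
    someVertex : V
    Adj        : Rel V 0ℓ
    adj?       : B.Decidable Adj
    adj-sym    : Symmetric Adj
    adj-irrefl : ∀ v → ¬ Adj v v

  order : ℕ
  order = length vertices

  -- The cardinality of { v | P v }.
  card : {P : Pred V 0ℓ} → U.Decidable P → ℕ
  card P? = length (filter P? vertices)

  any? : {P : Pred V 0ℓ} → U.Decidable P → Dec (∃ P)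
  any? P? = map′ (λ p → let v , _ , pv = find p in v , pv)
                 (λ (v , pv) → lose (complete v) pv)
                 (Any.any? P? vertices)

  all? : {P : Pred V 0ℓ} → U.Decidable P → Dec (∀ v → P v)
  all? P? = map′ (λ ps v → All.lookup ps (complete v))
                 (λ p → All.tabulate (λ {v} _ → p v))
                 (All.all? P? vertices)

  N : V → Pred V 0ℓ
  N v u = Adj v u

  degree : V → ℕ
  degree v = card (adj? v)

  -- The first argument of min and max is an element of the (nonempty) set of
  -- degrees, so it does not affect the result.
  δ : ℕ
  δ = min (degree someVertex) (map degree vertices)

  Δ : ℕ
  Δ = max (degree someVertex) (map degree vertices)

open Graph using (V; order; card; δ; Δ)

NoIsolatedVertices : Graph → Set
NoIsolatedVertices G = ∀ v → ∃ λ u → Graph.Adj G v u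

-- Lexicographic product.
infixr 7 _⊚_
_⊚_ : Graph → Graph → Graph
G ⊚ H = record
  { V          = G.V × H.V
  ; _≟_        = ≡-dec G._≟_ H._≟_
  ; vertices   = cartesianProduct G.vertices H.vertices
  ; unique     = cartesianProduct⁺ G.unique H.unique
  ; complete   = λ (u , v) → ∈-cartesianProduct⁺ (G.complete u) (H.complete v)
  ; someVertex = G.someVertex , H.someVertex
  ; Adj        = λ (u , v) (x , y) → G.Adj u x ⊎ (u ≡ x × H.Adj v y)
  ; adj?       = λ (u , v) (x , y) → G.adj? u x ⊎-dec (u G.≟ x ×-dec H.adj? v y)
  ; adj-sym    = λ { (inj₁ ux)          → inj₁ (G.adj-sym ux)
                   ; (inj₂ (refl , vy)) → inj₂ (refl , H.adj-sym vy) }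
  ; adj-irrefl = λ { (u , v) (inj₁ uu)       → G.adj-irrefl u uu
                   ; (u , v) (inj₂ (_ , vv)) → H.adj-irrefl v vv }
  }
  where
  module G = Graph G
  module H = Graph H

IsMinimum : {A : Set} → Pred A 0ℓ → (A → ℕ) → ℕ → Set
IsMinimum P w k = (∃ λ a → P a × w a ≡ k) × (∀ a → P a → k ≤ w a)

-- Minimising a quantity over the functions V G → B with a given property, for
-- a finite type B listed by bs.  Functions are enumerated up to pointwise
-- equality; the function a must have the property, so that the minimum exists.
module Minimisation (G : Graph) {B : Set} (bs : List B) (bs-complete : ∀ b → b ∈ bs) where

  open Graph G using (_≟_; vertices; complete)

  update : V G → B → (V G → B) → V G → B
  update v b g u = if does (v ≟ u) then b else g u

  functions : (V G → B) → List (V G) → List (V G → B)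
  functions a []       = a ∷ []
  functions a (v ∷ vs) = cartesianProductWith (update v) bs (functions a vs)

  functions-complete : ∀ a vs (f : V G → B) → ∃ λ g → g ∈ functions a vs × (∀ {u} → u ∈ vs → g u ≡ f u)
  functions-complete a []       f = a , here refl , λ ()
  functions-complete a (v ∷ vs) f with functions-complete a vs f
  ... | g , g∈ , g≡f = update v (f v) g , ∈-cartesianProductWith⁺ (update v) (bs-complete (f v)) g∈ , agree
    where
    agree : ∀ {u} → u ∈ v ∷ vs → update v (f v) g u ≡ f u
    agree {u} u∈ with v ≟ u
    agree     u∈         | yes refl = refl
    agree     (here u≡v) | no v≢u   = ⊥-elim (v≢u (sym u≡v))
    agree     (there u∈) | no _     = g≡f u∈

  module _ {P : Pred (V G → B) 0ℓ} (P? : U.Decidable P) (a : V G → B) (w : (V G → B) → ℕ) where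

    minimiser : V G → B
    minimiser = argmin w a (filter P? (functions a vertices))

    minimum : ℕ
    minimum = w minimiser

    minimum-attained : P a → ∃ λ f → P f × w f ≡ minimum
    minimum-attained pa = minimiser , argmin-all w pa (all-filter P? (functions a vertices)) , refl

    minimum-isMinimum : P a → (∀ {f g} → f ≗ g → P f → P g) → (∀ {f g} → f ≗ g → w f ≡ w g) →
                        IsMinimum P w minimum
    minimum-isMinimum pa P-resp w-resp = minimum-attained pa , lower
      where
      lower : ∀ f → P f → minimum ≤ w f
      lower f pf with functions-complete a vertices f
      ... | g , g∈ , g≡f = ≤-trans
        (All.lookup (f[argmin]≤f[xs] a _) (∈-filter⁺ P? g∈ (P-resp (λ u → sym (g≡f (complete u))) pf)))
        (≤-reflexive (w-resp (λ u → g≡f (complete u))))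

module _ (G : Graph) where

  open Graph G using (_≟_; vertices; Adj; adj?; any?; all?)

  IsPRDF : Pred (V G → Fin 3) 0ℓ
  IsPRDF f = ∀ u → f u ≡ zero → ∃! _≡_ λ v → Adj u v × f v ≡ suc (suc zero)

  weight : (V G → Fin 3) → ℕ
  weight f = sum (map (toℕ ∘ f) vertices)

  isPRDF? : U.Decidable IsPRDF
  isPRDF? f = all? λ u → (f u Fin.≟ zero) →-dec any? λ v → Q? u v ×-dec
    map′ (λ h {y} → h y) (λ h y → h {y}) (all? λ y → Q? u y →-dec (v ≟ y))
    where
    Q? : ∀ u v → Dec (Adj u v × f v ≡ suc (suc zero))
    Q? u v = adj? u v ×-dec (f v Fin.≟ suc (suc zero))

  module PRDF = Minimisation G (allFin 3) ∈-allFin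

  -- The perfect Roman domination number; the constant function 1 is a PRDF.
  γᴿᵖ : ℕ
  γᴿᵖ = PRDF.minimum isPRDF? (const (suc zero)) weight

  γᴿᵖ-isMinimum : IsMinimum IsPRDF weight γᴿᵖ
  γᴿᵖ-isMinimum = PRDF.minimum-isMinimum isPRDF? _ weight (λ _ ()) resp
    (λ f≗g → cong sum (map-cong (λ v → cong toℕ (f≗g v)) vertices))
    where
    resp : ∀ {f g} → f ≗ g → IsPRDF f → IsPRDF g
    resp f≗g pf u gu≡0 with pf u (trans (f≗g u) gu≡0)
    ... | v , (uv , fv≡2) , v-unique =
      v , (uv , trans (sym (f≗g v)) fv≡2) , λ (uy , gy≡2) → v-unique (uy , trans (f≗g _) gy≡2)

module OpenPackings (G : Graph) where

  open Graph G using (_≟_; Adj; adj?; N; any?; all?)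

  -- Sets of vertices, given by their characteristic functions.
  VertexSet : Set
  VertexSet = V G → Bool

  ⟦_⟧ : VertexSet → Pred (V G) 0ℓ
  ⟦ S ⟧ v = T (S v)

  N⟨_⟩ : VertexSet → Pred (V G) 0ℓ
  N⟨ S ⟩ u = ∃ λ v → ⟦ S ⟧ v × N v u

  N[_] : VertexSet → Pred (V G) 0ℓ
  N[ S ] = N⟨ S ⟩ ∪ ⟦ S ⟧

  -- The isolated vertices of the subgraph induced by S, and the other vertices of S.
  _₀ _₁ : VertexSet → Pred (V G) 0ℓ
  (S ₀) v = ⟦ S ⟧ v × (∀ u → ⟦ S ⟧ u → ¬ Adj v u)
  S ₁     = ⟦ S ⟧ ∖ (S ₀)

  N[_]? : ∀ S → U.Decidable N[ S ]
  N[ S ]? = (λ u → any? λ v → T? (S v) ×-dec adj? v u) ∪? (λ v → T? (S v))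

  _₀? : ∀ S → U.Decidable (S ₀)
  (S ₀?) v = T? (S v) ×-dec all? λ u → T? (S u) →-dec ¬? (adj? v u)

  _₁? : ∀ S → U.Decidable (S ₁)
  (S ₁?) v = T? (S v) ×-dec ¬? ((S ₀?) v)

  ∣_₀∣ ∣_₁∣ ∣N[_]∣ : VertexSet → ℕ
  ∣ S ₀∣   = card G (S ₀?)
  ∣ S ₁∣   = card G (S ₁?)
  ∣N[ S ]∣ = card G N[ S ]?

  IsOpenPacking : Pred VertexSet 0ℓ
  IsOpenPacking S = ∀ u v → ⟦ S ⟧ u → ⟦ S ⟧ v → u ≢ v → Empty (N u ∩ N v)

  isOpenPacking? : U.Decidable IsOpenPacking
  isOpenPacking? S = all? λ u → all? λ v → T? (S u) →-dec T? (S v) →-dec ¬? (u ≟ v) →-dec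
    all? λ x → ¬? (adj? u x ×-dec adj? v x)

  bools-complete : ∀ b → b ∈ true ∷ false ∷ []
  bools-complete true  = here refl
  bools-complete false = there (here refl)

  module Packing = Minimisation G (true ∷ false ∷ []) bools-complete

  -- The minimum of w over all open packings; the empty set is an open packing.
  min℘ₒ : (VertexSet → ℕ) → ℕ
  min℘ₒ = Packing.minimum isOpenPacking? (const false)

  min℘ₒ-isMinimum : (w : VertexSet → ℕ) → (∀ {S S′} → S ≗ S′ → w S ≡ w S′) →
                             IsMinimum IsOpenPacking w (min℘ₒ w)
  min℘ₒ-isMinimum w = Packing.minimum-isMinimum isOpenPacking? _ w (λ _ _ ()) resp
    where
    resp : ∀ {S S′} → S ≗ S′ → IsOpenPacking S → IsOpenPacking S′
    resp S≗S′ p u v u∈ v∈ = p u v (subst T (sym (S≗S′ u)) u∈) (subst T (sym (S≗S′ v)) v∈)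

-- Given an open packing S, colour the fibre over u in G ⊚ H as follows.
-- Over S₀ take a vertex v of maximum degree in H and put 2 on v, 0 on its
-- neighbours, 1 elsewhere.  Over S₁ take a vertex v of minimum degree and put
-- 2 on v, 1 on its neighbours, 0 elsewhere: those zeros are dominated from the
-- fibre over the unique neighbour of u in S.  Put 0 over N(S) ∖ S and 1 outside
-- N[S].  Every value 2 lies over S, and since distinct elements of S have no
-- common neighbour, no vertex of value 0 sees two of them.

module Submission where

open import Defs
open import Data.Nat.Base using (_+_; _*_; _∸_; _≤_)
open Graph using (order; δ; Δ)

open import Level using (0ℓ)
open import Data.Bool.Base using (if_then_else_)
open import Data.Bool.Properties using (T?)
open import Data.Fin.Base using (Fin; zero; suc; toℕ)
open import Data.List.Base using (List; []; _∷_; _++_; map; filter; length; cartesianProduct)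
open import Data.List.Extrema.Nat using (argmin-all; argmax-all)
open import Data.List.Properties using (map-++; map-∘; filter-none)
open import Data.List.Relation.Unary.All as All using ()
open import Data.List.Relation.Unary.All.Properties using (map⁺)
open import Data.List.Relation.Unary.AllPairs using ([]; _∷_)
open import Data.List.Relation.Unary.Unique.Propositional using (Unique)
open import Data.Nat.Base using (ℕ; suc; z≤n)
open import Data.Nat.ListAction using (sum)
open import Data.Nat.ListAction.Properties using (sum-++)
open import Data.Nat.Properties hiding (_≟_)
open import Data.Nat.Tactic.RingSolver using (solve-∀)
open import Data.Product using (∃; _×_; _,_; proj₁; proj₂; map₂)
open import Data.Sum.Base using (_⊎_; inj₁; inj₂)
open import Function.Base using (id; _∘_)
open import Relation.Binary using (DecidableEquality)
open import Relation.Binary.PropositionalEquality using (_≡_; refl; sym; trans; cong; cong₂; module ≡-Reasoning)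
open import Relation.Nullary using (¬_; Dec; does; yes; no; contradiction)
open import Relation.Nullary.Decidable using (¬?; dec-true; _×-dec_)
open import Relation.Unary using (Pred; Decidable)

-- Finite sums, indicators and counting over lists.

private
  variable
    A B : Set

∑ : List A → (A → ℕ) → ℕ
∑ xs f = sum (map f xs)

𝟙 : {P : Set} → Dec P → ℕ
𝟙 P? = if does P? then 1 else 0

∑-mono-≤ : ∀ (xs : List A) {f g} → (∀ x → f x ≤ g x) → ∑ xs f ≤ ∑ xs g
∑-mono-≤ []       f≤g = z≤n
∑-mono-≤ (x ∷ xs) f≤g = +-mono-≤ (f≤g x) (∑-mono-≤ xs f≤g)

∑-+ : ∀ (xs : List A) f g → ∑ xs (λ x → f x + g x) ≡ ∑ xs f + ∑ xs g
∑-+ []       f g = refl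
∑-+ (x ∷ xs) f g = begin
  f x + g x + ∑ xs (λ x → f x + g x)  ≡⟨ cong (f x + g x +_) (∑-+ xs f g) ⟩
  f x + g x + (∑ xs f + ∑ xs g)       ≡⟨ interchange (f x) (g x) (∑ xs f) (∑ xs g) ⟩
  f x + ∑ xs f + (g x + ∑ xs g)       ∎
  where
  open ≡-Reasoning
  interchange : ∀ a b c d → a + b + (c + d) ≡ a + c + (b + d)
  interchange = solve-∀

∑-*ʳ : ∀ (xs : List A) f c → ∑ xs (λ x → f x * c) ≡ ∑ xs f * c
∑-*ʳ []       f c = refl
∑-*ʳ (x ∷ xs) f c = trans (cong (f x * c +_) (∑-*ʳ xs f c)) (sym (*-distribʳ-+ c (f x) (∑ xs f)))

∑-const : ∀ (xs : List A) c → ∑ xs (λ _ → c) ≡ length xs * c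
∑-const []       c = refl
∑-const (x ∷ xs) c = cong (c +_) (∑-const xs c)

∑-cartesianProduct : ∀ (xs : List A) (ys : List B) f →
                     ∑ (cartesianProduct xs ys) f ≡ ∑ xs (λ x → ∑ ys (λ y → f (x , y)))
∑-cartesianProduct []       ys f = refl
∑-cartesianProduct (x ∷ xs) ys f = begin
  sum (map f (map (x ,_) ys ++ cartesianProduct xs ys))
    ≡⟨ cong sum (map-++ f (map (x ,_) ys) _) ⟩
  sum (map f (map (x ,_) ys) ++ map f (cartesianProduct xs ys))
    ≡⟨ sum-++ (map f (map (x ,_) ys)) _ ⟩
  sum (map f (map (x ,_) ys)) + ∑ (cartesianProduct xs ys) f
    ≡⟨ cong₂ _+_ (cong sum (sym (map-∘ ys))) (∑-cartesianProduct xs ys f) ⟩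
  ∑ ys (λ y → f (x , y)) + ∑ xs (λ x → ∑ ys (λ y → f (x , y))) ∎
  where open ≡-Reasoning

module _ {P : Pred A 0ℓ} (P? : Decidable P) where

  ∑-𝟙 : ∀ xs → ∑ xs (λ x → 𝟙 (P? x)) ≡ length (filter P? xs)
  ∑-𝟙 []       = refl
  ∑-𝟙 (x ∷ xs) with P? x
  ... | yes _ = cong suc (∑-𝟙 xs)
  ... | no  _ = ∑-𝟙 xs

  length-filter-¬ : ∀ xs → length (filter P? xs) + length (filter (¬? ∘ P?) xs) ≡ length xs
  length-filter-¬ []       = refl
  length-filter-¬ (x ∷ xs) with P? x
  ... | yes _ = cong suc (length-filter-¬ xs)
  ... | no  _ = trans (+-suc _ _) (cong suc (length-filter-¬ xs))

  ≤-𝟙* : ∀ {x} m → P x → m ≤ 𝟙 (P? x) * m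
  ≤-𝟙* {x} m px rewrite dec-true (P? x) px = m≤m+n m 0

length-filter-≟ : (_≟_ : DecidableEquality A) → ∀ v {xs} → Unique xs → length (filter (v ≟_) xs) ≤ 1
length-filter-≟ _≟_ v []               = z≤n
length-filter-≟ _≟_ v (_∷_ {x} x∉xs u) with v ≟ x
... | no  _    = length-filter-≟ _≟_ v u
-- The head is `v` and differs from all later entries, so filtering the tail leaves nothing.
... | yes refl rewrite filter-none (v ≟_) x∉xs = ≤-refl

-- Colourings of a single copy of `H`.

pattern two = suc (suc zero)

module Fibres (H : Graph) where

  open Graph H hiding (order; δ; Δ)

  δ-attained : ∃ λ v → degree v ≡ δ H
  -- `min` starts from the degree of `someVertex`, so that default must itself be shown to be a
  -- degree.
  δ-attained = argmin-all id {P = λ k → ∃ λ v → degree v ≡ k} (someVertex , refl)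
    (map⁺ (All.universal (λ v → v , refl) vertices))

  Δ-attained : ∃ λ v → degree v ≡ Δ H
  Δ-attained = argmax-all id {P = λ k → ∃ λ v → degree v ≡ k} (someVertex , refl)
    (map⁺ (All.universal (λ v → v , refl) vertices))

  count-≟ : ∀ v → ∑ vertices (λ y → 𝟙 (v ≟ y)) ≤ 1
  count-≟ v = ≤-trans (≤-reflexive (∑-𝟙 (v ≟_) vertices)) (length-filter-≟ _≟_ v unique)

  star costar : V → V → Fin 3
  star v y with v ≟ y | adj? v y
  ... | yes _ | _     = two
  ... | no  _ | yes _ = zero
  ... | no  _ | no  _ = suc zero

  costar v y with v ≟ y | adj? v y
  ... | yes _ | _     = two
  ... | no  _ | yes _ = suc zero
  ... | no  _ | no  _ = zero

  star-centre : ∀ v → star v v ≡ two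
  star-centre v with v ≟ v
  ... | yes _   = refl
  ... | no  v≢v = contradiction refl v≢v

  costar-centre : ∀ v → costar v v ≡ two
  costar-centre v with v ≟ v
  ... | yes _   = refl
  ... | no  v≢v = contradiction refl v≢v

  star-two : ∀ v {y} → star v y ≡ two → v ≡ y
  star-two v {y} eq with v ≟ y | adj? v y
  star-two v eq | yes v≡y | _     = v≡y
  star-two v () | no _    | yes _
  star-two v () | no _    | no _

  costar-two : ∀ v {y} → costar v y ≡ two → v ≡ y
  costar-two v {y} eq with v ≟ y | adj? v y
  costar-two v eq | yes v≡y | _     = v≡y
  costar-two v () | no _    | yes _
  costar-two v () | no _    | no _

  star-zero : ∀ v {y} → star v y ≡ zero → Adj v y
  star-zero v {y} eq with v ≟ y | adj? v y
  star-zero v () | yes _ | _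
  star-zero v eq | no _  | yes vy = vy
  star-zero v () | no _  | no _

  costar-zero : ∀ v {y} → costar v y ≡ zero → ¬ Adj v y
  costar-zero v {y} eq with v ≟ y | adj? v y
  costar-zero v () | yes _ | _
  costar-zero v () | no _  | yes _
  costar-zero v eq | no _  | no ¬vy = ¬vy

  -- Adding `degree v` makes the count pointwise: each neighbour's 0 is topped up to 1, so every
  -- vertex counts 1 and the centre one more. Cancelling the degree gives the bound.
  ∑-star : ∀ v → ∑ vertices (toℕ ∘ star v) ≤ order H ∸ degree v + 1
  ∑-star v = +-cancelʳ-≤ (degree v) _ _ (begin
    ∑ vertices (toℕ ∘ star v) + degree v
      ≡⟨ cong (∑ vertices (toℕ ∘ star v) +_) (∑-𝟙 (adj? v) vertices) ⟨
    ∑ vertices (toℕ ∘ star v) + ∑ vertices (λ y → 𝟙 (adj? v y))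
      ≡⟨ ∑-+ vertices _ _ ⟨
    ∑ vertices (λ y → toℕ (star v y) + 𝟙 (adj? v y))
      ≤⟨ ∑-mono-≤ vertices pointwise ⟩
    ∑ vertices (λ y → 1 + 𝟙 (v ≟ y))
      ≡⟨ ∑-+ vertices _ _ ⟩
    ∑ vertices (λ _ → 1) + ∑ vertices (λ y → 𝟙 (v ≟ y))
      ≤⟨ +-mono-≤ (≤-reflexive (trans (∑-const vertices 1) (*-identityʳ _))) (count-≟ v) ⟩
    order H + 1
      -- This inequality holds for truncated subtraction, without first comparing degree and order.
      ≤⟨ +-monoˡ-≤ 1 (m≤n+m∸n (order H) (degree v)) ⟩
    degree v + (order H ∸ degree v) + 1
      ≡⟨ rearrange (degree v) (order H ∸ degree v) ⟩
    order H ∸ degree v + 1 + degree v ∎)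
    where
    open ≤-Reasoning
    rearrange : ∀ d m → d + m + 1 ≡ m + 1 + d
    rearrange = solve-∀
    pointwise : ∀ y → toℕ (star v y) + 𝟙 (adj? v y) ≤ 1 + 𝟙 (v ≟ y)
    pointwise y with v ≟ y | adj? v y
    -- A loop at `v` would give 3 against 2; irreflexivity rules it out.
    ... | yes refl | yes vv = contradiction vv (adj-irrefl v)
    ... | yes _    | no  _  = ≤-refl
    ... | no  _    | yes _  = ≤-refl
    ... | no  _    | no  _  = ≤-refl

  ∑-costar : ∀ v → ∑ vertices (toℕ ∘ costar v) ≤ 2 + degree v
  ∑-costar v = begin
    ∑ vertices (toℕ ∘ costar v)
      ≤⟨ ∑-mono-≤ vertices pointwise ⟩
    ∑ vertices (λ y → 𝟙 (v ≟ y) * 2 + 𝟙 (adj? v y))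
      ≡⟨ ∑-+ vertices _ _ ⟩
    ∑ vertices (λ y → 𝟙 (v ≟ y) * 2) + ∑ vertices (λ y → 𝟙 (adj? v y))
      ≡⟨ cong₂ _+_ (∑-*ʳ vertices _ 2) (∑-𝟙 (adj? v) vertices) ⟩
    ∑ vertices (λ y → 𝟙 (v ≟ y)) * 2 + degree v
      ≤⟨ +-monoˡ-≤ (degree v) (*-monoˡ-≤ 2 (count-≟ v)) ⟩
    2 + degree v ∎
    where
    open ≤-Reasoning
    pointwise : ∀ y → toℕ (costar v y) ≤ 𝟙 (v ≟ y) * 2 + 𝟙 (adj? v y)
    pointwise y with v ≟ y | adj? v y
    ... | yes _ | _     = m≤m+n 2 _
    ... | no  _ | yes _ = ≤-refl
    ... | no  _ | no  _ = ≤-refl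

-- The colouring of the product built from `S`.

module Construction (G H : Graph) (S : OpenPackings.VertexSet G) where

  open Graph G using (V; Adj; vertices; adj-sym)
  open OpenPackings G
  open Fibres H
  module G = Graph G
  module H = Graph H

  -- The constructors carry membership evidence, so facts about fibres go by cases on an arbitrary
  -- position without unfolding `position`.
  data Position (u : V) : Set where
    isolated  : (S ₀) u → Position u
    matched   : (S ₁) u → Position u
    dominated : ¬ ⟦ S ⟧ u → N⟨ S ⟩ u → Position u
    outside   : ¬ N[ S ] u → Position u

  position : ∀ u → Position u
  position u with N[ S ]? u | T? (S u) | (S ₀?) u
  ... | no  u∉       | _       | _       = outside u∉
  ... | yes (inj₂ u∈) | _       | yes u∈₀ = isolated u∈₀
  ... | yes (inj₂ u∈) | _       | no  u∉₀ = matched (u∈ , u∉₀)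
  -- `N⟨ S ⟩` and `S` may overlap, so a vertex reported as a neighbour must still be tested for
  -- membership in `S`.
  ... | yes (inj₁ _)  | yes _   | yes u∈₀ = isolated u∈₀
  ... | yes (inj₁ _)  | yes u∈  | no  u∉₀ = matched (u∈ , u∉₀)
  ... | yes (inj₁ Nu) | no  u∉  | _       = dominated u∉ Nu

  fibre : ∀ {u} → Position u → H.V → Fin 3
  fibre (isolated _)    = star (proj₁ Δ-attained)
  fibre (matched _)     = costar (proj₁ δ-attained)
  fibre (dominated _ _) = λ _ → zero
  fibre (outside _)     = λ _ → suc zero

  colouring : V × H.V → Fin 3
  colouring (u , y) = fibre (position u) y

  centre : ∀ {u} → Position u → H.V
  centre (isolated _) = proj₁ Δ-attained
  -- Over `dominated` and `outside` positions this is a mere default: no 2 lies there.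
  centre _            = proj₁ δ-attained

  fibre-two : ∀ {u} (p : Position u) {y} → fibre p y ≡ two → ⟦ S ⟧ u × centre p ≡ y
  fibre-two (isolated (u∈ , _)) eq = u∈ , star-two _ eq
  fibre-two (matched (u∈ , _))  eq = u∈ , costar-two _ eq

  fibre-centre : ∀ {u} (p : Position u) → ⟦ S ⟧ u → fibre p (centre p) ≡ two
  fibre-centre (isolated _)     u∈ = star-centre _
  fibre-centre (matched _)      u∈ = costar-centre _
  fibre-centre (dominated u∉ _) u∈ = contradiction u∈ u∉
  fibre-centre (outside u∉)     u∈ = contradiction (inj₂ u∈) u∉

  -- Existence and uniqueness of the dominating vertex.

  hub : V → H.V
  hub u = centre (position u)

  -- A matched zero is not adjacent to its own hub, and an isolated one has no
  -- neighbour in S.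
  fibre-zero-exclusive : ∀ {u s} (p : Position u) {y} → fibre p y ≡ zero → ⟦ S ⟧ u →
                         ⟦ S ⟧ s → Adj u s → ¬ H.Adj (centre p) y
  fibre-zero-exclusive (isolated (_ , iso)) eq u∈ s∈ us = contradiction us (iso _ s∈)
  fibre-zero-exclusive (matched _)          eq u∈ s∈ us = costar-zero _ eq
  fibre-zero-exclusive (dominated u∉ _)     eq u∈       = contradiction u∈ u∉

  -- Membership in `S ₁` only denies isolation; a finite search turns the denial into a witness.
  matched-neighbour : ∀ {u} → (S ₁) u → ∃ λ s → ⟦ S ⟧ s × Adj u s
  matched-neighbour {u} (u∈ , u∉₀) with G.any? (λ s → T? (S s) ×-dec G.adj? u s)
  ... | yes found = found
  ... | no  none  = contradiction (u∈ , λ s s∈ us → none (s , s∈ , us)) u∉₀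

  -- Over `S ₀` a zero is dominated inside its own fibre; elsewhere by a neighbouring fibre, where
  -- adjacency in `G` alone suffices.
  fibre-zero : ∀ {u} (p : Position u) {y} → fibre p y ≡ zero →
               ∃ λ s → ⟦ S ⟧ s × (Adj u s ⊎ u ≡ s × H.Adj (centre p) y)
  fibre-zero {u} (isolated (u∈ , _)) eq = u , u∈ , inj₂ (refl , star-zero _ eq)
  fibre-zero (matched u∈₁)           eq = map₂ (map₂ inj₁) (matched-neighbour u∈₁)
  fibre-zero (dominated _ (s , s∈ , su)) eq = s , s∈ , inj₁ (adj-sym su)

  dominator : ∀ u {y} → colouring (u , y) ≡ zero →
              ∃ λ s → ⟦ S ⟧ s × Graph.Adj (G ⊚ H) (u , y) (s , hub s)
  dominator u eq with fibre-zero (position u) eq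
  ... | s , s∈ , inj₁ us          = s , s∈ , inj₁ us
  ... | s , s∈ , inj₂ (refl , hy) = s , s∈ , inj₂ (refl , H.adj-sym hy)

  -- Two dominators in fibres other than that of `u` make `u` a common neighbour of two elements of
  -- `S`, against the packing property. If just one lies in the fibre of `u`, then `u` is in `S`
  -- with a neighbour in `S`, which `fibre-zero-exclusive` forbids.
  dominator-unique : IsOpenPacking S → ∀ {u y} → colouring (u , y) ≡ zero →
    ∀ {s t} → ⟦ S ⟧ s → ⟦ S ⟧ t →
    Graph.Adj (G ⊚ H) (u , y) (s , hub s) → Graph.Adj (G ⊚ H) (u , y) (t , hub t) → s ≡ t
  dominator-unique packing {u} eq {s} {t} s∈ t∈ adjₛ adjₜ with s G.≟ t
  ... | yes s≡t = s≡t
  ... | no  s≢t = clash adjₛ adjₜ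
    where
    clash : Graph.Adj (G ⊚ H) (u , _) (s , hub s) → Graph.Adj (G ⊚ H) (u , _) (t , hub t) → s ≡ t
    clash (inj₁ us)          (inj₁ ut)          =
      contradiction (adj-sym us , adj-sym ut) (packing s t s∈ t∈ s≢t u)
    clash (inj₁ us)          (inj₂ (refl , yh)) =
      contradiction (H.adj-sym yh) (fibre-zero-exclusive (position u) eq t∈ s∈ us)
    clash (inj₂ (refl , yh)) (inj₁ ut)          =
      contradiction (H.adj-sym yh) (fibre-zero-exclusive (position u) eq s∈ t∈ ut)
    clash (inj₂ (refl , _))  (inj₂ (refl , _))  = refl

  colouring-isPRDF : IsOpenPacking S → IsPRDF (G ⊚ H) colouring
  colouring-isPRDF packing (u , y) eq with dominator u eq
  ... | s , s∈ , adjₛ = (s , hub s) , (adjₛ , fibre-centre (position s) s∈) , only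
    where
    only : ∀ {v} → Graph.Adj (G ⊚ H) (u , y) v × colouring v ≡ two → (s , hub s) ≡ v
    only {t , z} (adjₜ , eq₂) with fibre-two (position t) eq₂
    -- Here `z` has become `hub t`, so comparing first coordinates is enough.
    ... | t∈ , refl = cong (λ v → v , hub v) (dominator-unique packing eq s∈ t∈ adjₛ adjₜ)

  -- The weight of the colouring.

  bound : ℕ
  bound = ∣ S ₀∣ * (order H ∸ Δ H + 1) + ∣ S ₁∣ * (2 + δ H) + order H * (order G ∸ ∣N[ S ]∣)

  -- `bound` distributed over the vertices of `G`: each pays according to its class, and those in
  -- `N⟨ S ⟩` but not in `S` pay nothing.
  cost : V → ℕ
  cost u = 𝟙 ((S ₀?) u) * (order H ∸ Δ H + 1) + 𝟙 ((S ₁?) u) * (2 + δ H) + 𝟙 (¬? (N[ S ]? u)) * order H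

  -- The evidence in `p` sets the matching indicator to 1, and the other summands are nonnegative.
  ∑-fibre : ∀ {u} (p : Position u) → ∑ H.vertices (toℕ ∘ fibre p) ≤ cost u
  ∑-fibre {u} (isolated u∈₀) = begin
    ∑ H.vertices (toℕ ∘ star (proj₁ Δ-attained))      ≤⟨ ∑-star _ ⟩
    order H ∸ H.degree (proj₁ Δ-attained) + 1         ≡⟨ cong (λ d → order H ∸ d + 1) (proj₂ Δ-attained) ⟩
    order H ∸ Δ H + 1                                 ≤⟨ ≤-𝟙* (S ₀?) _ u∈₀ ⟩
    𝟙 ((S ₀?) u) * (order H ∸ Δ H + 1)                ≤⟨ m≤m+n _ _ ⟩
    𝟙 ((S ₀?) u) * (order H ∸ Δ H + 1) + 𝟙 ((S ₁?) u) * (2 + δ H) ≤⟨ m≤m+n _ _ ⟩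
    cost u                                            ∎
    where open ≤-Reasoning
  ∑-fibre {u} (matched u∈₁) = begin
    ∑ H.vertices (toℕ ∘ costar (proj₁ δ-attained))    ≤⟨ ∑-costar _ ⟩
    2 + H.degree (proj₁ δ-attained)                   ≡⟨ cong (2 +_) (proj₂ δ-attained) ⟩
    2 + δ H                                           ≤⟨ ≤-𝟙* (S ₁?) _ u∈₁ ⟩
    𝟙 ((S ₁?) u) * (2 + δ H)                          ≤⟨ m≤n+m _ _ ⟩
    𝟙 ((S ₀?) u) * (order H ∸ Δ H + 1) + 𝟙 ((S ₁?) u) * (2 + δ H) ≤⟨ m≤m+n _ _ ⟩
    cost u                                            ∎
    where open ≤-Reasoning
  ∑-fibre {u} (dominated _ _) = begin
    ∑ H.vertices (λ _ → 0)  ≡⟨ ∑-const H.vertices 0 ⟩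
    order H * 0             ≡⟨ *-zeroʳ (order H) ⟩
    0                       ≤⟨ z≤n ⟩
    cost u                  ∎
    where open ≤-Reasoning
  ∑-fibre {u} (outside u∉) = begin
    ∑ H.vertices (λ _ → 1)            ≡⟨ ∑-const H.vertices 1 ⟩
    order H * 1                       ≡⟨ *-identityʳ (order H) ⟩
    order H                           ≤⟨ ≤-𝟙* (¬? ∘ N[ S ]?) _ u∉ ⟩
    𝟙 (¬? (N[ S ]? u)) * order H      ≤⟨ m≤n+m _ _ ⟩
    cost u                            ∎
    where open ≤-Reasoning

  ∑-𝟙* : {P : Pred V 0ℓ} (P? : Decidable P) → ∀ c → ∑ vertices (λ u → 𝟙 (P? u) * c) ≡ G.card P? * c
  ∑-𝟙* P? c = trans (∑-*ʳ vertices (𝟙 ∘ P?) c) (cong (_* c) (∑-𝟙 P? vertices))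

  ∑-cost : ∑ vertices cost ≡ bound
  ∑-cost = begin
    ∑ vertices cost
      ≡⟨ ∑-+ vertices _ _ ⟩
    ∑ vertices (λ u → 𝟙 ((S ₀?) u) * (order H ∸ Δ H + 1) + 𝟙 ((S ₁?) u) * (2 + δ H)) +
    ∑ vertices (λ u → 𝟙 (¬? (N[ S ]? u)) * order H)
      ≡⟨ cong₂ _+_ (∑-+ vertices _ _) refl ⟩
    ∑ vertices (λ u → 𝟙 ((S ₀?) u) * (order H ∸ Δ H + 1)) +
    ∑ vertices (λ u → 𝟙 ((S ₁?) u) * (2 + δ H)) +
    ∑ vertices (λ u → 𝟙 (¬? (N[ S ]? u)) * order H)
      ≡⟨ cong₂ _+_ (cong₂ _+_ (∑-𝟙* (S ₀?) _) (∑-𝟙* (S ₁?) _)) uncovered ⟩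
    bound ∎
    where
    open ≡-Reasoning
    complement : G.card (¬? ∘ N[ S ]?) ≡ order G ∸ ∣N[ S ]∣
    -- The two filters split the vertex list, so the truncated subtraction is exact.
    complement = trans (sym (m+n∸m≡n ∣N[ S ]∣ _)) (cong (_∸ ∣N[ S ]∣) (length-filter-¬ N[ S ]? vertices))
    uncovered : ∑ vertices (λ u → 𝟙 (¬? (N[ S ]? u)) * order H) ≡ order H * (order G ∸ ∣N[ S ]∣)
    uncovered = begin
      ∑ vertices (λ u → 𝟙 (¬? (N[ S ]? u)) * order H) ≡⟨ ∑-𝟙* (¬? ∘ N[ S ]?) (order H) ⟩
      G.card (¬? ∘ N[ S ]?) * order H                 ≡⟨ cong (_* order H) complement ⟩
      (order G ∸ ∣N[ S ]∣) * order H                  ≡⟨ *-comm _ (order H) ⟩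
      order H * (order G ∸ ∣N[ S ]∣)                  ∎

  weight-colouring : weight (G ⊚ H) colouring ≤ bound
  weight-colouring = begin
    weight (G ⊚ H) colouring
      ≡⟨ ∑-cartesianProduct vertices H.vertices (toℕ ∘ colouring) ⟩
    ∑ vertices (λ u → ∑ H.vertices (toℕ ∘ fibre (position u)))
      ≤⟨ ∑-mono-≤ vertices (∑-fibre ∘ position) ⟩
    ∑ vertices cost
      ≡⟨ ∑-cost ⟩
    bound ∎
    where open ≤-Reasoning

  γᴿᵖ≤bound : IsOpenPacking S → γᴿᵖ (G ⊚ H) ≤ bound
  γᴿᵖ≤bound packing = ≤-trans
    (proj₂ (γᴿᵖ-isMinimum (G ⊚ H)) colouring (colouring-isPRDF packing)) weight-colouring

-- Passage to the minimum over open packings.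

theorem4p3 : (G H : Graph) → NoIsolatedVertices G → let open OpenPackings G in
    γᴿᵖ (G ⊚ H) ≤ min℘ₒ (λ S →
    ∣ S ₀∣ * (order H ∸ Δ H + 1) + ∣ S ₁∣ * (2 + δ H) + order H * (order G ∸ ∣N[ S ]∣))
theorem4p3 G H _ =
  let S , packing , attained = best
  in ≤-trans (Construction.γᴿᵖ≤bound G H S packing) (≤-reflexive attained)
  where
  open OpenPackings G
  best : ∃ λ S → IsOpenPacking S × Construction.bound G H S ≡ min℘ₒ (Construction.bound G H)
  -- `λ _ _ ()` certifies that the empty set, the default of the search, is an open packing; hence
  -- the minimum is the bound of an actual packing.
  best = Packing.minimum-attained isOpenPacking? _ (Construction.bound G H) (λ _ _ ())
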